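{- Let $k$ be an odd integer with $k\ge 5$, let $D$ be a strong $k$-quasi-transitive digraph with $\mathrm{diam}(D)\ge k+2$, let $u,v\in V(D)$ with $d(u,v)=k+2$, and let $P$ be a shortest $(u,v)$-path in $D$. Then $D[V(P)]$ is either a semicomplete digraph or a semicomplete bipartite digraph.
   Context: All digraphs are finite, without loops or multiple arcs (opposite arcs allowed). Vertices $x,y$ are adjacent if $xy$ or $yx$ is an arc. For $k\ge 2$, $D$ is $k$-quasi-transitive if for every path $x_0x_1\ldots x_k$ of length $k$, $x_0$ and $x_k$ are adjacent. $d(x,y)$ is the length of a shortest $(x,y)$-path, $\mathrm{diam}(D)=\max_{x,y}d(x,y)$. $D[S]$ is the induced subdigraph. A semicomplete digraph: every two distinct vertices adjacent. A semicomplete bipartite digraph: there is a bipartition $(X,Y)$ of the vertex set with no arcs inside $X$ or $Y$ and every vertex of $X$ adjacent to every vertex of $Y$. -}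

module Defs where

open import Data.Fin.Base using (Fin; zero; suc; fromℕ; inject₁)
open import Data.Fin.Properties using (_≟_; any?)
open import Data.Fin.Subset using (Subset; inside; outside; _∈_; _∉_; ∣_∣)
open import Data.Nat.Base using (ℕ; suc; _≤_)
open import Data.Product.Base using (Σ; ∃; ∃₂; _×_; _,_)
open import Data.Sum.Base using (_⊎_)
open import Data.Vec.Base using (_∷_; tabulate)
open import Function.Definitions using (Injective)
open import Level using (0ℓ)
open import Relation.Binary.Core using (Rel)
open import Relation.Binary.Definitions using (Decidable; Irreflexive)
open import Relation.Binary.PropositionalEquality using (_≡_; _≢_; refl)
open import Relation.Nullary using (¬_; does)

-- Arcs form a binary relation, so there are no parallel arcs; opposite arcs are
-- allowed.  Decidability makes the arc set an honest finite set.
record Digraph : Set₁ where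
  field
    order : ℕ

  Vertex : Set
  Vertex = Fin order

  field
    Arc      : Rel Vertex 0ℓ
    arc?     : Decidable Arc
    loopless : Irreflexive _≡_ Arc

  Adjacent : Rel Vertex 0ℓ
  Adjacent x y = Arc x y ⊎ Arc y x

open Digraph public using (Vertex)

-- A directed path x₀ x₁ … xₗ from x to y; its length l is the number of arcs.
record Path (D : Digraph) (x y : Vertex D) (l : ℕ) : Set where
  field
    vertex   : Fin (suc l) → Vertex D
    source   : vertex zero ≡ x
    target   : vertex (fromℕ l) ≡ y
    distinct : Injective _≡_ _≡_ vertex
    arcs     : ∀ (i : Fin l) → Digraph.Arc D (vertex (inject₁ i)) (vertex (suc i))

module _ (D : Digraph) where
  open Digraph D using (Arc; Adjacent)

  QuasiTransitive : ℕ → Set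
  QuasiTransitive k = ∀ (x y : Vertex D) → Path D x y k → Adjacent x y

  Strong : Set
  Strong = ∀ (x y : Vertex D) → ∃ λ l → Path D x y l

  Shortest : ∀ {x y : Vertex D} {l : ℕ} → Path D x y l → Set
  Shortest {x} {y} {l} _ = ∀ (m : ℕ) → Path D x y m → l ≤ m

  -- d(x,y) = m.  If there is no path from x to y, this holds for no m.
  IsDistance : Vertex D → Vertex D → ℕ → Set
  IsDistance x y m = Σ (Path D x y m) Shortest

  -- diam(D) = m: every distance is finite and at most m, and m is attained.
  IsDiameter : ℕ → Set
  IsDiameter m =
    (∀ (x y : Vertex D) → ∃ λ l → IsDistance x y l × l ≤ m) ×
    (∃₂ λ (x y : Vertex D) → IsDistance x y m)

  Semicomplete : Set
  Semicomplete = ∀ (x y : Vertex D) → x ≢ y → Adjacent x y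

  -- A bipartition (X , Y) is given by X, with Y the complement of X.
  SemicompleteBipartite : Set
  SemicompleteBipartite = ∃ λ (X : Subset (Digraph.order D)) →
    (∀ (x y : Vertex D) → x ∈ X → y ∈ X → ¬ Arc x y) ×
    (∀ (x y : Vertex D) → x ∉ X → y ∉ X → ¬ Arc x y) ×
    (∀ (x y : Vertex D) → x ∈ X → y ∉ X → Adjacent x y)

-- The increasing enumeration of the elements of S.
enumerate : ∀ {n : ℕ} (S : Subset n) → Fin ∣ S ∣ → Fin n
enumerate (outside ∷ S) i       = suc (enumerate S i)
enumerate (inside  ∷ S) zero    = zero
enumerate (inside  ∷ S) (suc i) = suc (enumerate S i)

-- D[S], with the vertices in S renumbered as Fin ∣ S ∣ in increasing order.
induced : ∀ (D : Digraph) → Subset (Digraph.order D) → Digraph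
induced D S = record
  { order    = ∣ S ∣
  ; Arc      = λ i j → Arc (enumerate S i) (enumerate S j)
  ; arc?     = λ i j → arc? (enumerate S i) (enumerate S j)
  ; loopless = λ { refl → loopless refl }
  }
  where open Digraph D

vertexSet : ∀ {D : Digraph} {x y : Vertex D} {l : ℕ} →
            Path D x y l → Subset (Digraph.order D)
vertexSet P = tabulate λ v → does (any? λ i → Path.vertex P i ≟ v)

{-# OPTIONS --safe #-}
module Submission where

open import Defs
open import Data.Bool.Base using (Bool; true; false; not)
open import Data.Bool.Properties using (not-involutive; not-¬; ¬-not) renaming (_≟_ to _≟ᵇ_)
open import Data.Empty using (⊥-elim)
open import Data.Fin.Base using (Fin; zero; suc; toℕ; fromℕ; fromℕ<; inject₁)
open import Data.Fin.Properties
  using (_≟_; any?; toℕ-injective; toℕ-fromℕ; toℕ-fromℕ<; toℕ-inject₁; toℕ≤pred[n])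
  renaming (suc-injective to Fin-suc-injective)
open import Data.Fin.Subset using (Subset; inside; outside; _∈_; _∉_; ∣_∣)
open import Data.Nat using (ℕ; zero; suc; _+_; _*_; _%_; _≥_; _≤_; _<_; _⊓_; z≤n; s≤s)
open import Data.Nat.DivMod using (m*n%n≡0)
open import Data.Nat.Properties hiding (_≟_)
open import Data.Nat.Tactic.RingSolver using (solve-∀)
open import Data.Product.Base using (∃; ∃₂; _×_; _,_; proj₁; proj₂)
open import Data.Sum using (_⊎_; inj₁; inj₂; [_,_]′; swap)
open import Data.Unit.Base using (⊤; tt)
open import Data.Vec.Base using (_∷_; tabulate; here; there)
open import Data.Vec.Properties using (lookup∘tabulate; []=⇒lookup; lookup⇒[]=)
open import Function.Base using (_∘_; id)
open import Level using (0ℓ)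
open import Relation.Binary.Definitions using (tri<; tri≈; tri>)
open import Relation.Binary.PropositionalEquality
open import Relation.Nullary using (¬_; Dec; yes; no; does)
open import Relation.Nullary.Decidable using (_×-dec_)
open import Relation.Unary using (Pred)

-- Number P as x₀ … x_N with N = k + 2 odd.  As P is shortest, the only arcs xᵢ → xⱼ with
-- i < j are those of P, so a path of length k whose ends xⱼ, xᵢ satisfy j ≥ i + 2 forces
-- the arc xⱼ → xᵢ.  The paths used are chains of increasing runs, each run below the
-- previous one, that miss exactly two of the N + 1 vertices.  They produce every arc
-- xⱼ → xᵢ with j − i ≥ 3 odd.  If some arc joins positions of equal parity, it can be
-- stretched to x_{N-1} → x₀ or x_N → x₁; each of these gives the other, and together
-- they give every arc xⱼ → xᵢ with j − i ≥ 2 even.  Otherwise parity is a bipartition.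

-- Extending a path at its source.

module _ {D : Digraph} where
  open Digraph D using (Arc)
  open Path

  trivialPath : ∀ x → Path D x x 0
  trivialPath x = record
    { vertex = λ _ → x ; source = refl ; target = refl
    ; distinct = λ { {zero} {zero} _ → refl } ; arcs = λ () }

  prepend : ∀ {x y z l} → Arc x y → (p : Path D y z l) →
            (∀ t → vertex p t ≢ x) → Path D x z (suc l)
  prepend {x} {l = l} x→y p x∉p = record
    { vertex = vs ; source = refl ; target = target p
    ; distinct = inj _ _ ; arcs = as }
    where
    vs : Fin (suc (suc l)) → Vertex D
    vs zero    = x
    vs (suc t) = vertex p t

    inj : ∀ s t → vs s ≡ vs t → s ≡ t
    inj zero    zero    _  = refl
    inj zero    (suc t) eq = ⊥-elim (x∉p t (sym eq))
    inj (suc s) zero    eq = ⊥-elim (x∉p s eq)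
    inj (suc s) (suc t) eq = cong suc (distinct p eq)

    as : ∀ i → Arc (vs (inject₁ i)) (vs (suc i))
    as zero    = subst (Arc x) (sym (source p)) x→y
    as (suc i) = arcs p i

-- Routes through the positions of a geodesic.

module Geodesic
  {D : Digraph} {k N : ℕ} (N≡2+k : N ≡ 2 + k) (quasiTransitive : QuasiTransitive D k)
  {u v : Vertex D} (P : Path D u v N) (shortest : Shortest D P)
  where
  open Digraph D using (Arc; Adjacent)
  open Path

  abstract
    -- For i > N this is the last vertex of P (junk value).
    x : ℕ → Vertex D
    x i = vertex P (fromℕ< (s≤s (m⊓n≤n i N)))

    x-toℕ : ∀ t → vertex P t ≡ x (toℕ t)
    x-toℕ t = cong (vertex P) (toℕ-injective
      (sym (trans (toℕ-fromℕ< _) (m≤n⇒m⊓n≡m (toℕ≤pred[n] t)))))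

    x-injective : ∀ {i j} → i ≤ N → j ≤ N → x i ≡ x j → i ≡ j
    x-injective {i} {j} i≤N j≤N eq = begin
      i                                        ≡⟨ m≤n⇒m⊓n≡m i≤N ⟨
      i ⊓ N                                    ≡⟨ toℕ-fromℕ< _ ⟨
      toℕ (fromℕ< (s≤s (m⊓n≤n i N)))           ≡⟨ cong toℕ (distinct P eq) ⟩
      toℕ (fromℕ< (s≤s (m⊓n≤n j N)))           ≡⟨ toℕ-fromℕ< _ ⟩
      j ⊓ N                                    ≡⟨ m≤n⇒m⊓n≡m j≤N ⟩
      j                                        ∎
      where open ≡-Reasoning

  x-start : x 0 ≡ u
  x-start = trans (sym (x-toℕ zero)) (source P)

  x-end : x N ≡ v
  x-end = trans (cong x (sym (toℕ-fromℕ N))) (trans (sym (x-toℕ (fromℕ N))) (target P))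

  infix 4 _⟶_
  _⟶_ : ℕ → ℕ → Set
  i ⟶ j = Arc (x i) (x j)

  step : ∀ {i} → i < N → i ⟶ suc i
  step {i} i<N = subst₂ Arc
    (trans (x-toℕ (inject₁ t)) (cong x (trans (toℕ-inject₁ t) (toℕ-fromℕ< i<N))))
    (trans (x-toℕ (suc t)) (cong (x ∘ suc) (toℕ-fromℕ< i<N)))
    (arcs P t)
    where t = fromℕ< i<N

  -- `Q` is only an upper bound on the visited positions: a vertex whose position violates `Q` is
  -- certainly new. The bound `h ≤ N` makes `x-injective` applicable to that comparison.
  record Route (Q : Pred ℕ 0ℓ) (j i c : ℕ) : Set where
    field
      path     : Path D (x j) (x i) c
      position : ∀ t → ∃ λ h → Q h × h ≤ N × vertex path t ≡ x h

  open Route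

  stay : ∀ {i} → i ≤ N → Route (_≡ i) i i 0
  stay {i} i≤N = record { path = trivialPath (x i) ; position = λ _ → i , refl , i≤N , refl }

  weaken : ∀ {Q R : Pred ℕ 0ℓ} {j i c} → (∀ {h} → Q h → h ≤ N → R h) →
           Route Q j i c → Route R j i c
  weaken Q⊆R r = record
    { path = path r
    ; position = λ t → let h , q , h≤N , eq = position r t in h , Q⊆R q h≤N , h≤N , eq }

  cons : ∀ {Q : Pred ℕ 0ℓ} {m j i c} → m ⟶ j → m ≤ N → ¬ Q m →
         Route Q j i c → Route (λ h → h ≡ m ⊎ Q h) m i (suc c)
  cons {Q} {m} m→j m≤N m∉Q r = record { path = prepend m→j (path r) fresh ; position = pos }
    where
    fresh : ∀ t → vertex (path r) t ≢ x m
    fresh t eq with h , q , h≤N , eq′ ← position r t =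
      m∉Q (subst Q (x-injective h≤N m≤N (trans (sym eq′) eq)) q)

    pos : ∀ t → ∃ λ h → (h ≡ m ⊎ Q h) × h ≤ N × vertex (prepend m→j (path r) fresh) t ≡ x h
    pos zero    = m , inj₁ refl , m≤N , refl
    pos (suc t) = let h , q , h≤N , eq = position r t in h , inj₂ q , h≤N , eq

  -- The given route already starts at `m`, so the new vertices are only `a … m - 1`; this is why
  -- `Q` may hold at `m` itself and above.
  prependRun : ∀ {Q : Pred ℕ 0ℓ} {m i c} s a → a + s ≡ m → m ≤ N →
               (∀ {h} → Q h → h < a ⊎ m ≤ h) → Route Q m i c →
               Route (λ h → Q h ⊎ (a ≤ h × h ≤ m)) a i (s + c)
  prependRun zero a eq m≤N avoids r with refl ← trans (sym (+-identityʳ a)) eq =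
    weaken (λ q _ → inj₁ q) r
  prependRun {Q} {m} (suc s) a eq m≤N avoids r =
    weaken merge (cons (step (≤-trans a<m m≤N)) (≤-trans (<⇒≤ a<m) m≤N) fresh
      (prependRun s (suc a) (trans (sym (+-suc a s)) eq) m≤N avoids′ r))
    where
    a<m : a < m
    a<m = subst (a <_) eq (m<m+n a (s≤s z≤n))

    avoids′ : ∀ {h} → Q h → h < suc a ⊎ m ≤ h
    avoids′ q with avoids q
    ... | inj₁ h<a = inj₁ (m<n⇒m<1+n h<a)
    ... | inj₂ m≤h = inj₂ m≤h

    fresh : ¬ (Q a ⊎ (a < a × a ≤ m))
    fresh (inj₂ (a<a , _)) = <-irrefl refl a<a
    fresh (inj₁ q) with avoids q
    ... | inj₁ a<a = <-irrefl refl a<a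
    ... | inj₂ m≤a = <-irrefl refl (<-≤-trans a<m m≤a)

    merge : ∀ {h} → h ≡ a ⊎ (Q h ⊎ (a < h × h ≤ m)) → h ≤ N → Q h ⊎ (a ≤ h × h ≤ m)
    merge (inj₁ refl)                   _ = inj₂ (≤-refl , <⇒≤ a<m)
    merge (inj₂ (inj₁ q))               _ = inj₁ q
    merge (inj₂ (inj₂ (a<h , h≤m)))     _ = inj₂ (<⇒≤ a<h , h≤m)

  -- Otherwise `0 … i → j … N` would be a path from `u` to `v` of length `N - 1 - d`.
  noShortcut : ∀ {i j} d → 2 + i + d ≡ j → j ≤ N → ¬ i ⟶ j
  noShortcut {i} {j} d eq j≤N i→j with s , j+s≡N ← m≤n⇒∃[o]m+o≡n j≤N =
    <-irrefl refl (≤-trans shorter (shortest _ shortcut))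
    where
    i<j : i < j
    i<j = subst (i <_) eq (≤-trans (n≤1+n _) (m≤m+n (2 + i) d))

    tail : Route (j ≤_) j N (s + 0)
    tail = weaken (λ { (inj₁ refl) _ → j≤N ; (inj₂ (j≤h , _)) _ → j≤h })
      (prependRun s j j+s≡N ≤-refl (λ { refl → inj₂ ≤-refl }) (stay ≤-refl))

    route : Route _ 0 N (i + suc (s + 0))
    route = prependRun i 0 refl i≤N
      (λ { (inj₁ refl) → inj₂ ≤-refl ; (inj₂ j≤h) → inj₂ (≤-trans (<⇒≤ i<j) j≤h) })
      (cons i→j i≤N (λ j≤i → <-irrefl refl (<-≤-trans i<j j≤i)) tail)
      where
      i≤N : i ≤ N
      i≤N = ≤-trans (<⇒≤ i<j) j≤N

    shortcut : Path D u v (i + suc (s + 0))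
    shortcut = subst₂ (λ a b → Path D a b _) x-start x-end (path route)

    shorter : suc (i + suc (s + 0)) ≤ N
    shorter = subst (suc (i + suc (s + 0)) ≤_) j+s≡N
      (subst (λ n → suc (i + suc (s + 0)) ≤ n + s) eq
        (subst (suc (i + suc (s + 0)) ≤_) (rearrange i s d) (m≤m+n _ d)))
      where
      rearrange : ∀ i s d → suc (i + suc (s + 0)) + d ≡ 2 + i + d + s
      rearrange = solve-∀

  -- Descents and the arcs they force.

  -- A path from j to i through positions in [0 .. top], all but `missed` of which are visited.
  record Descent (top j i missed : ℕ) : Set where
    field
      {length}  : ℕ
      start≤top : j ≤ top
      count     : length + missed ≡ top
      route     : top ≤ N → Route (_≤ top) j i length

  open Descent

  -- The missed positions are `0 … l - 1`.
  run : ∀ l t {i} → l + t ≡ i → Descent i l i l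
  run l t {i} eq = record
    { start≤top = l≤i
    ; count     = trans (rearrange l t) eq
    ; route     = λ i≤N → weaken (λ { (inj₁ refl) _ → ≤-refl ; (inj₂ (_ , h≤i)) _ → h≤i })
                    (prependRun t l eq i≤N (λ { refl → inj₂ ≤-refl }) (stay i≤N))
    }
    where
    l≤i : l ≤ i
    l≤i = subst (l ≤_) eq (m≤m+n l t)

    rearrange : ∀ l t → t + 0 + l ≡ l + t
    rearrange = solve-∀

  -- The run `j … m` lies above everything visited later, and the `g` positions strictly between
  -- `top` and `j` are the newly missed ones. Nested calls list the runs in the order in which the
  -- path traverses them.
  runThenJump : ∀ g s {top a i missed j m} → suc (g + top) ≡ j → j + s ≡ m → m ⟶ a →
                Descent top a i missed → Descent m j i (g + missed)
  runThenJump g s {top} {a} {i} {missed} {j} {m} refl eq m→a d = record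
    { start≤top = j≤m
    ; count     = counted
    ; route     = λ m≤N →
        weaken (λ { (inj₁ (inj₁ refl)) _ → ≤-refl
                  ; (inj₁ (inj₂ h≤top)) _ → ≤-trans h≤top (≤-trans (<⇒≤ top<j) j≤m)
                  ; (inj₂ (_ , h≤m)) _ → h≤m })
          (prependRun s j eq m≤N
            (λ { (inj₁ refl) → inj₂ ≤-refl ; (inj₂ h≤top) → inj₁ (≤-<-trans h≤top top<j) })
            (cons m→a m≤N (λ m≤top → <-irrefl refl (≤-<-trans m≤top (<-≤-trans top<j j≤m)))
              (route d (≤-trans (<⇒≤ top<j) (≤-trans j≤m m≤N)))))
    }
    where
    top<j : top < j
    top<j = s≤s (m≤n+m top g)

    j≤m : j ≤ m
    j≤m = subst (j ≤_) eq (m≤m+n j s)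

    rearrange : ∀ s c g missed →
                s + suc c + (g + missed) ≡ suc (g + (c + missed)) + s
    rearrange = solve-∀

    counted : s + suc (length d) + (g + missed) ≡ m
    counted with c ← length d | refl ← count d = trans (rearrange s c g missed) eq

  -- The `e` positions above `top` are missed as well, which makes two missed positions out of
  -- `N + 1`; hence the path has length `N - 2`, that is `k`.
  adjacent : ∀ e {top j i missed} → Descent top j i missed →
             e + missed ≡ 2 → e + top ≡ N → Adjacent (x j) (x i)
  adjacent e {top} {j} {i} {missed} d e+missed≡2 e+top≡N =
    quasiTransitive (x j) (x i) (subst (Path D (x j) (x i)) length≡k (path (route d top≤N)))
    where
    top≤N : top ≤ N
    top≤N = subst (top ≤_) e+top≡N (m≤n+m top e)

    length≡k : length d ≡ k
    length≡k = +-cancelˡ-≡ 2 (length d) k (begin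
      2 + length d              ≡⟨ cong (_+ length d) e+missed≡2 ⟨
      e + missed + length d     ≡⟨ +-assoc e missed (length d) ⟩
      e + (missed + length d)   ≡⟨ cong (e +_) (+-comm missed (length d)) ⟩
      e + (length d + missed)   ≡⟨ cong (e +_) (count d) ⟩
      e + top                   ≡⟨ trans e+top≡N N≡2+k ⟩
      2 + k                     ∎)
      where open ≡-Reasoning

  -- Of the two arcs that adjacency allows, `noShortcut` excludes the forward one, since the gap
  -- `2 + δ` is at least two.
  close : ∀ e δ {top j i missed} → Descent top j i missed →
          e + missed ≡ 2 → e + top ≡ N → 2 + i + δ ≡ j → j ⟶ i
  close e δ {top} d e+missed≡2 e+top≡N gap with adjacent e d e+missed≡2 e+top≡N
  ... | inj₁ j→i = j→i
  ... | inj₂ i→j = ⊥-elim (noShortcut δ gap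
          (≤-trans (start≤top d) (subst (top ≤_) e+top≡N (m≤n+m top e))) i→j)

-- Parity of gaps between positions.

parity : ∀ n → ∃ λ m → n ≡ m * 2 ⊎ n ≡ 1 + m * 2
parity zero = 0 , inj₁ refl
parity (suc n) with parity n
... | m , inj₁ refl = m     , inj₂ refl
... | m , inj₂ refl = suc m , inj₁ refl

m*2≢1+n*2 : ∀ m n → m * 2 ≢ 1 + n * 2
m*2≢1+n*2 m n eq = even≢odd m n (trans (*-comm 2 m) (trans eq (cong suc (*-comm n 2))))

isOdd : ℕ → Bool
isOdd zero    = false
isOdd (suc n) = not (isOdd n)

isOdd-even+ : ∀ d i → isOdd (d * 2 + i) ≡ isOdd i
isOdd-even+ zero    i = refl
isOdd-even+ (suc d) i = trans (not-involutive _) (isOdd-even+ d i)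

gapParity : ∀ {i j} → i < j → ∃ λ d → j ≡ 1 + (d * 2 + i) ⊎ j ≡ 2 + (d * 2 + i)
gapParity {i} i<j with e , refl ← m≤n⇒∃[o]m+o≡n i<j with parity e
... | d , inj₁ refl = d , inj₁ (cong suc (+-comm i (d * 2)))
... | d , inj₂ refl = d , inj₂ (cong suc (+-comm i (1 + d * 2)))

evenGap : ∀ {i j} → i < j → isOdd i ≡ isOdd j → ∃ λ d → j ≡ 2 + (d * 2 + i)
evenGap {i} i<j same with gapParity i<j
... | d , inj₂ eq   = d , eq
... | d , inj₁ refl = ⊥-elim (not-¬ refl (trans same (cong not (isOdd-even+ d i))))

oddGap : ∀ {i j} → i < j → isOdd i ≢ isOdd j → ∃ λ d → j ≡ 1 + (d * 2 + i)
oddGap {i} i<j differ with gapParity i<j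
... | d , inj₁ eq   = d , eq
... | d , inj₂ refl = ⊥-elim (differ (sym (isOdd-even+ (suc d) i)))

-- Vertices of an induced subdigraph.

enumerate-∈ : ∀ {n} (S : Subset n) a → enumerate S a ∈ S
enumerate-∈ (outside ∷ S) a       = there (enumerate-∈ S a)
enumerate-∈ (inside  ∷ S) zero    = here
enumerate-∈ (inside  ∷ S) (suc a) = there (enumerate-∈ S a)

enumerate-injective : ∀ {n} (S : Subset n) {a b} → enumerate S a ≡ enumerate S b → a ≡ b
enumerate-injective (outside ∷ S) eq = enumerate-injective S (Fin-suc-injective eq)
enumerate-injective (inside  ∷ S) {zero}  {zero}  _  = refl
enumerate-injective (inside  ∷ S) {suc a} {suc b} eq =
  cong suc (enumerate-injective S (Fin-suc-injective eq))

vertexSet⁻ : ∀ {D : Digraph} {u v w : Vertex D} {l} (P : Path D u v l) →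
             w ∈ vertexSet P → ∃ λ t → Path.vertex P t ≡ w
vertexSet⁻ {w = w} P w∈S = witness (any? λ t → Path.vertex P t ≟ w)
  (trans (sym (lookup∘tabulate _ w)) ([]=⇒lookup w∈S))
  where
  witness : ∀ {A : Set} (A? : Dec A) → does A? ≡ true → A
  witness (yes a) _ = a

-- First backward arcs on a geodesic of odd length.

module OddGeodesic
  {D : Digraph} (r : ℕ) (quasiTransitive : QuasiTransitive D (5 + r * 2))
  {u v : Vertex D} (P : Path D u v (7 + r * 2)) (shortest : Shortest D P)
  where
  open Geodesic refl quasiTransitive P shortest
  open Digraph D using (Arc; Adjacent)

  N : ℕ
  N = 7 + r * 2

  -- The segment `i … i + k` of `P` is itself a path of length `k`, with `i` positions missed below
  -- and `e` above. It runs forward, so `close` does not fit and the forward arc is excluded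
  -- directly.
  backByK : ∀ i e → e + i ≡ 2 → i + (5 + r * 2) ⟶ i
  backByK i e eq =
    [ ⊥-elim ∘ noShortcut (3 + r * 2) (rearrange i r) i+k≤N , id ]′
      (adjacent e (run i (5 + r * 2) refl) eq
        (trans (sym (+-assoc e i _)) (cong (_+ (5 + r * 2)) eq)))
    where
    rearrange : ∀ i r → 2 + i + (3 + r * 2) ≡ i + (5 + r * 2)
    rearrange = solve-∀

    i+k≤N : i + (5 + r * 2) ≤ N
    i+k≤N = +-monoˡ-≤ (5 + r * 2) (subst (i ≤_) eq (m≤n+m i e))

  N⟶2 : N ⟶ 2
  N⟶2 = backByK 2 0 refl

  N-2⟶0 : 5 + r * 2 ⟶ 0
  N-2⟶0 = backByK 0 2 refl

  -- N → 2 … N-2 → 0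
  N⟶0 : N ⟶ 0
  N⟶0 = close 0 (5 + r * 2)
    (runThenJump 1 0 refl (+-identityʳ _) N⟶2
      (runThenJump 1 (3 + r * 2) refl refl N-2⟶0 (run 0 0 refl)))
    refl refl refl

  -- 3+i … N → 0 … i
  backByThree : ∀ i s → 3 + i + s ≡ N → 3 + i ⟶ i
  backByThree i s eq = close 0 1 (runThenJump 2 s refl eq N⟶0 (run 0 i refl)) refl refl (cong (2 +_) (+-comm i 1))

  -- 4+p … N → 2 … 2+p → q, used with q ≤ 1
  raiseTail : ∀ g q p s → g + q ≡ 1 → 4 + p + s ≡ N → 2 + p ⟶ q → 4 + p ⟶ q
  raiseTail g q p s eq eqN arc = close 0 (g + (1 + p))
    (runThenJump 1 s refl eqN N⟶2
      (runThenJump g p (cong suc eq) refl arc (run q 0 (+-identityʳ q))))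
    (cong suc eq) refl (trans (rearrange g q p) (cong (λ n → 3 + n + p) eq))
    where
    rearrange : ∀ g q p → 2 + q + (g + (1 + p)) ≡ 3 + (g + q) + p
    rearrange = solve-∀

  -- p → 2+q … N-2 → 0 … q, used with p ≥ N-1
  lowerHead : ∀ e g p q s → g + e ≡ 1 → g + (6 + r * 2) ≡ p → 4 + q + s ≡ N →
              p ⟶ 2 + q → p ⟶ q
  lowerHead e g p q s eq eqp eqN arc = close e (g + (1 + s))
    (runThenJump g 0 (trans (sym (+-suc g (5 + r * 2))) eqp) (+-identityʳ p) arc
      (runThenJump 1 s refl (suc-injective (suc-injective eqN)) N-2⟶0 (run 0 q refl)))
    (trans (rearrange₁ e g) (cong suc eq)) e+p≡N
    (trans (rearrange₂ g q s) (trans (cong (λ n → g + n) (suc-injective eqN)) eqp))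
    where
    rearrange₁ : ∀ e g → e + (g + 1) ≡ 1 + (g + e)
    rearrange₁ = solve-∀

    rearrange₂ : ∀ g q s → 2 + q + (g + (1 + s)) ≡ g + (3 + q + s)
    rearrange₂ = solve-∀

    rearrange₃ : ∀ e g n → e + (g + n) ≡ (g + e) + n
    rearrange₃ = solve-∀

    e+p≡N : e + p ≡ N
    e+p≡N = trans (cong (e +_) (sym eqp))
      (trans (rearrange₃ e g (6 + r * 2)) (cong (_+ (6 + r * 2)) eq))

  -- Backward arcs over odd gaps.

  odd⟶0 : ∀ m s → 3 + m * 2 + s ≡ N → 3 + m * 2 ⟶ 0
  odd⟶0 zero    s eq = backByThree 0 s eq
  odd⟶0 (suc m) s eq = raiseTail 1 0 (1 + m * 2) s refl eq
    (odd⟶0 m (2 + s) (trans (rearrange m s) eq))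
    where
    rearrange : ∀ m s → 3 + m * 2 + (2 + s) ≡ 5 + m * 2 + s
    rearrange = solve-∀

  -- Mirror image of `odd⟶0`: there the tail of `3 ⟶ 0` is raised by twos, here the head of
  -- `N ⟶ N - 3` is lowered by twos. The oddness in the name is that of the gap `N - q`; the head
  -- `q` is even.
  N⟶oddBelow : ∀ m q → 3 + m * 2 + q ≡ N → N ⟶ q
  N⟶oddBelow zero    q eq = subst (_⟶ q) eq (backByThree q 0 (trans (+-identityʳ _) eq))
  N⟶oddBelow (suc m) q eq = lowerHead 0 1 N q (1 + m * 2) refl refl (trans (rearrange₁ m q) eq)
    (N⟶oddBelow m (2 + q) (trans (rearrange₂ m q) eq))
    where
    rearrange₁ : ∀ m q → 4 + q + (1 + m * 2) ≡ 5 + m * 2 + q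
    rearrange₁ = solve-∀

    rearrange₂ : ∀ m q → 3 + m * 2 + (2 + q) ≡ 5 + m * 2 + q
    rearrange₂ = solve-∀

  -- As `N` is odd, its gap to an even position is odd, so `N⟶oddBelow` covers every even head up to
  -- `N - 2`.
  N⟶even : ∀ m s → 2 + m * 2 + s ≡ N → N ⟶ m * 2
  N⟶even m s eq with parity s
  ... | z , inj₁ refl = ⊥-elim (m*2≢1+n*2 (1 + m + z) (3 + r) (trans (rearrange m z) eq))
    where
    rearrange : ∀ m z → (1 + m + z) * 2 ≡ 2 + m * 2 + z * 2
    rearrange = solve-∀
  ... | z , inj₂ refl = N⟶oddBelow z (m * 2) (trans (rearrange m z) eq)
    where
    rearrange : ∀ m z → 3 + z * 2 + m * 2 ≡ 2 + m * 2 + (1 + z * 2)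
    rearrange = solve-∀

  -- 4+w+i … N → 2+i … 2+w+i → 0 … i
  viaEnds : ∀ i w s → 4 + (w + i) + s ≡ N → N ⟶ 2 + i → 2 + (w + i) ⟶ 0 → 4 + (w + i) ⟶ i
  viaEnds i w s eq from to = close 0 (2 + w)
    (runThenJump 1 s refl eq from
      (runThenJump 1 w refl (cong (2 +_) (+-comm i w)) to (run 0 i refl)))
    refl refl (gap i w)
    where
    gap : ∀ i w → 2 + i + (2 + w) ≡ 4 + (w + i)
    gap = solve-∀

  -- 4+w+i … N → 1+i … 1+w+i → 0 … i
  viaEnds′ : ∀ i w s → 4 + (w + i) + s ≡ N → N ⟶ 1 + i → 1 + (w + i) ⟶ 0 → 4 + (w + i) ⟶ i
  viaEnds′ i w s eq from to = close 0 (2 + w)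
    (runThenJump 2 s refl eq from
      (runThenJump 0 w refl (cong suc (+-comm i w)) to (run 0 i refl)))
    refl refl (gap i w)
    where
    gap : ∀ i w → 2 + i + (2 + w) ≡ 4 + (w + i)
    gap = solve-∀

  -- The arcs at hand lead from `N` to even positions and from odd positions to `0`. The parity of
  -- `i` selects the one of `viaEnds` and `viaEnds′` whose two inner jumps are of these kinds.
  oddJump : ∀ d i s → 3 + (d * 2 + i) + s ≡ N → 3 + (d * 2 + i) ⟶ i
  oddJump zero    i s eq = backByThree i s eq
  oddJump (suc d) i s eq with parity i
  ... | m , inj₁ refl = viaEnds (m * 2) (1 + d * 2) s eq
      (N⟶even (1 + m) (1 + (d * 2 + s)) (trans (rearrange₁ m d s) eq))
      (subst (_⟶ 0) (rearrange₂ m d) (odd⟶0 (d + m) (2 + s) (trans (rearrange₃ m d s) eq)))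
    where
    rearrange₁ : ∀ m d s → 2 + (1 + m) * 2 + (1 + (d * 2 + s)) ≡ 5 + (d * 2 + m * 2) + s
    rearrange₁ = solve-∀

    rearrange₂ : ∀ m d → 3 + (d + m) * 2 ≡ 2 + (1 + d * 2 + m * 2)
    rearrange₂ = solve-∀

    rearrange₃ : ∀ m d s → 3 + (d + m) * 2 + (2 + s) ≡ 5 + (d * 2 + m * 2) + s
    rearrange₃ = solve-∀
  ... | m , inj₂ refl = viaEnds′ (1 + m * 2) (1 + d * 2) s eq
      (N⟶even (1 + m) (2 + (d * 2 + s)) (trans (rearrange₁ m d s) eq))
      (subst (_⟶ 0) (rearrange₂ m d) (odd⟶0 (d + m) (3 + s) (trans (rearrange₃ m d s) eq)))
    where
    rearrange₁ : ∀ m d s → 2 + (1 + m) * 2 + (2 + (d * 2 + s)) ≡ 5 + (d * 2 + (1 + m * 2)) + s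
    rearrange₁ = solve-∀

    rearrange₂ : ∀ m d → 3 + (d + m) * 2 ≡ 1 + (1 + d * 2 + (1 + m * 2))
    rearrange₂ = solve-∀

    rearrange₃ : ∀ m d s → 3 + (d + m) * 2 + (3 + s) ≡ 5 + (d * 2 + (1 + m * 2)) + s
    rearrange₃ = solve-∀

  -- Stretching a backward arc over an even gap.

  -- With p = 4+2d+i: the path 2+p … N → a … p → 2+i … b → 0 … i, where b is the odd
  -- element of {2+i, 3+i} and a = b+1.
  widen : ∀ d i s → 6 + (d * 2 + i) + s ≡ N → 4 + (d * 2 + i) ⟶ 2 + i → 6 + (d * 2 + i) ⟶ i
  widen d i s eq arc with parity i
  ... | m , inj₁ refl = close 0 (4 + d * 2)
      (runThenJump 1 s refl eq (N⟶even (2 + m) (d * 2 + s) (trans (rearrange₁ m d s) eq))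
        (runThenJump 0 (d * 2) refl (cong (4 +_) (+-comm (m * 2) (d * 2))) arc
          (runThenJump 1 1 refl (+-comm _ 1) (odd⟶0 m (3 + (d * 2 + s)) (trans (rearrange₂ m d s) eq))
            (run 0 (m * 2) refl))))
      refl refl (gap m d)
    where
    rearrange₁ : ∀ m d s → 2 + (2 + m) * 2 + (d * 2 + s) ≡ 6 + (d * 2 + m * 2) + s
    rearrange₁ = solve-∀

    rearrange₂ : ∀ m d s → 3 + m * 2 + (3 + (d * 2 + s)) ≡ 6 + (d * 2 + m * 2) + s
    rearrange₂ = solve-∀

    gap : ∀ m d → 2 + m * 2 + (4 + d * 2) ≡ 6 + (d * 2 + m * 2)
    gap = solve-∀
  ... | m , inj₂ refl = close 0 (4 + d * 2)
      (runThenJump 1 s refl eq (N⟶even (2 + m) (1 + (d * 2 + s)) (trans (rearrange₁ m d s) eq))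
        (runThenJump 0 (1 + d * 2) refl (rearrange₃ m d) arc
          (runThenJump 1 0 refl (+-identityʳ _) (odd⟶0 m (4 + (d * 2 + s)) (trans (rearrange₂ m d s) eq))
            (run 0 (1 + m * 2) refl))))
      refl refl (gap m d)
    where
    rearrange₁ : ∀ m d s → 2 + (2 + m) * 2 + (1 + (d * 2 + s)) ≡ 6 + (d * 2 + (1 + m * 2)) + s
    rearrange₁ = solve-∀

    rearrange₂ : ∀ m d s → 3 + m * 2 + (4 + (d * 2 + s)) ≡ 6 + (d * 2 + (1 + m * 2)) + s
    rearrange₂ = solve-∀

    rearrange₃ : ∀ m d → 4 + m * 2 + (1 + d * 2) ≡ 4 + (d * 2 + (1 + m * 2))
    rearrange₃ = solve-∀

    gap : ∀ m d → 2 + (1 + m * 2) + (4 + d * 2) ≡ 6 + (d * 2 + (1 + m * 2))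
    gap = solve-∀

  -- The largest even gap within `0 … N` is `N - 1`, and only these two jumps span it.
  LongEvenJump : Set
  LongEvenJump = 6 + r * 2 ⟶ 0 ⊎ N ⟶ 1

  -- Raise the tail by twos until `s` is at most 1. Since the gap is even and `N` is odd, head `0`
  -- can only end with tail `N - 1`, and head `1` only with tail `N`.
  longFromLow : ∀ g q d s → g + q ≡ 1 → 2 + (d * 2 + q) + s ≡ N →
                2 + (d * 2 + q) ⟶ q → LongEvenJump
  longFromLow g q d (suc (suc s)) eq eqN arc =
    longFromLow g q (suc d) s eq eqN′ (raiseTail g q (d * 2 + q) s eq eqN′ arc)
    where
    rearrange : ∀ d q s → 4 + (d * 2 + q) + s ≡ 2 + (d * 2 + q) + (2 + s)
    rearrange = solve-∀

    eqN′ : 4 + (d * 2 + q) + s ≡ N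
    eqN′ = trans (rearrange d q s) eqN
  longFromLow g zero d 0 eq eqN arc = ⊥-elim (m*2≢1+n*2 (1 + d) (3 + r) (trans (rearrange d) eqN))
    where
    rearrange : ∀ d → (1 + d) * 2 ≡ 2 + (d * 2 + 0) + 0
    rearrange = solve-∀
  longFromLow g zero d 1 eq eqN arc =
    inj₁ (subst (_⟶ 0) (suc-injective (trans (+-comm 1 _) eqN)) arc)
  longFromLow g (suc zero) d 0 eq eqN arc =
    inj₂ (subst (_⟶ 1) (trans (sym (+-identityʳ _)) eqN) arc)
  longFromLow g (suc zero) d 1 eq eqN arc =
    ⊥-elim (m*2≢1+n*2 (2 + d) (3 + r) (trans (rearrange d) eqN))
    where
    rearrange : ∀ d → (2 + d) * 2 ≡ 2 + (d * 2 + 1) + 1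
    rearrange = solve-∀
  longFromLow (suc g) (suc (suc q)) d s eq eqN arc = ⊥-elim (m+1+n≢0 g (suc-injective eq))
  longFromLow zero (suc (suc q)) d s () eqN arc

  -- Each round lowers the head by two, until it is `0` or `1` and `longFromLow` takes over. `widen`
  -- also raises the tail by two; where no room is left for that, `lowerHead` keeps the tail fixed.
  long : ∀ q d s → 2 + (d * 2 + q) + s ≡ N → 2 + (d * 2 + q) ⟶ q → LongEvenJump
  long zero          d s eqN arc = longFromLow 1 0 d s refl eqN arc
  long (suc zero)    d s eqN arc = longFromLow 0 1 d s refl eqN arc
  long (suc (suc i)) d s eqN arc = go s (trans (cong (_+ s) (sym head)) eqN)
    where
    rearrange : ∀ d i → 2 + (d * 2 + (2 + i)) ≡ 4 + (d * 2 + i)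
    rearrange = solve-∀

    head : 2 + (d * 2 + (2 + i)) ≡ 4 + (d * 2 + i)
    head = rearrange d i

    arc′ : 4 + (d * 2 + i) ⟶ 2 + i
    arc′ = subst (_⟶ 2 + i) head arc

    rearrange₁ : ∀ d i s → 4 + i + (d * 2 + s) ≡ 4 + (d * 2 + i) + s
    rearrange₁ = solve-∀

    rearrange₂ : ∀ d i s → 6 + (d * 2 + i) + s ≡ 4 + (d * 2 + i) + (2 + s)
    rearrange₂ = solve-∀

    go : ∀ s → 4 + (d * 2 + i) + s ≡ N → LongEvenJump
    -- With tail `N` the path skips `N - 1`, a gap between runs; with tail `N - 1`, in the next
    -- clause, it misses `N`, which lies above its top.
    go 0 eq = long i (1 + d) 0 eq
      (lowerHead 0 1 _ i (d * 2 + 0) refl (trans (sym eq) (+-identityʳ _))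
        (trans (rearrange₁ d i 0) eq) arc′)
    go 1 eq = long i (1 + d) 1 eq
      (lowerHead 1 0 _ i (d * 2 + 1) refl (suc-injective (trans (sym eq) (+-comm _ 1)))
        (trans (rearrange₁ d i 1) eq) arc′)
    go (suc (suc s)) eq = long i (2 + d) s eq′ (widen d i s eq′ arc′)
      where
      eq′ : 6 + (d * 2 + i) + s ≡ N
      eq′ = trans (rearrange₂ d i s) eq

  -- Backward arcs over even gaps.

  even⟶0 : 2 ⟶ 0 → ∀ m s → 2 + m * 2 + s ≡ N → 2 + m * 2 ⟶ 0
  even⟶0 2⟶0 zero    s eq = 2⟶0
  even⟶0 2⟶0 (suc m) s eq = raiseTail 1 0 (m * 2) s refl eq
    (even⟶0 2⟶0 m (2 + s) (trans (rearrange m s) eq))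
    where
    rearrange : ∀ m s → 2 + m * 2 + (2 + s) ≡ 4 + m * 2 + s
    rearrange = solve-∀

  -- Repeated lowering of the head, now starting from `N - 2`; the gap `N - q` is even, so `q` is
  -- odd.
  N⟶evenBelow : N ⟶ 5 + r * 2 → ∀ m q → 2 + m * 2 + q ≡ N → N ⟶ q
  N⟶evenBelow N⟶N-2 zero    q eq = subst (N ⟶_) (suc-injective (suc-injective (sym eq))) N⟶N-2
  N⟶evenBelow N⟶N-2 (suc m) q eq = lowerHead 0 1 N q (m * 2) refl refl (trans (rearrange₁ m q) eq)
    (N⟶evenBelow N⟶N-2 m (2 + q) (trans (rearrange₂ m q) eq))
    where
    rearrange₁ : ∀ m q → 4 + q + m * 2 ≡ 4 + m * 2 + q
    rearrange₁ = solve-∀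

    rearrange₂ : ∀ m q → 2 + m * 2 + (2 + q) ≡ 4 + m * 2 + q
    rearrange₂ = solve-∀

  -- 2 … N-1 → 0
  2⟶0 : 6 + r * 2 ⟶ 0 → 2 ⟶ 0
  2⟶0 N-1⟶0 = close 1 0 (runThenJump 1 (4 + r * 2) refl refl N-1⟶0 (run 0 0 refl)) refl refl refl

  -- N → 1 … N-2
  N⟶N-2 : N ⟶ 1 → N ⟶ 5 + r * 2
  N⟶N-2 N⟶1 = close 0 0
    (runThenJump 1 0 refl (+-identityʳ _) N⟶1 (run 1 (4 + r * 2) refl)) refl refl (+-identityʳ _)

  -- N → 2 … N-3 → 0 1
  N⟶1-from : 6 + r * 2 ⟶ 0 → N ⟶ 1
  N⟶1-from N-1⟶0 = close 0 (4 + r * 2)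
    (runThenJump 2 0 refl (+-identityʳ _) N⟶2
      (runThenJump 0 (2 + r * 2) refl refl (even⟶0 (2⟶0 N-1⟶0) (1 + r) 3 (rearrange r))
        (run 0 1 refl)))
    refl refl refl
    where
    rearrange : ∀ r → 2 + (1 + r) * 2 + 3 ≡ 7 + r * 2
    rearrange = solve-∀

  -- N-1 N → 3 … N-2 → 0
  N-1⟶0-from : N ⟶ 1 → 6 + r * 2 ⟶ 0
  N-1⟶0-from N⟶1 = close 0 (4 + r * 2)
    (runThenJump 0 1 refl (+-comm _ 1) (N⟶evenBelow (N⟶N-2 N⟶1) (1 + r) 3 (rearrange r))
      (runThenJump 2 (2 + r * 2) refl refl N-2⟶0 (run 0 0 refl)))
    refl refl refl
    where
    rearrange : ∀ r → 2 + (1 + r) * 2 + 3 ≡ 7 + r * 2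
    rearrange = solve-∀

  bothLong : LongEvenJump → 6 + r * 2 ⟶ 0 × N ⟶ 1
  bothLong (inj₁ N-1⟶0) = N-1⟶0 , N⟶1-from N-1⟶0
  bothLong (inj₂ N⟶1)   = N-1⟶0-from N⟶1 , N⟶1

  -- Combined with the arcs over odd gaps, the two long jumps give `N ⟶ q` for all `q` up to `N - 2`
  -- and `p ⟶ 0` for all `p` from 2 on. Hence `viaEnds` works for `i` of either parity; it produces
  -- gaps of at least four, so gaps of two are treated apart.
  evenJump : LongEvenJump → ∀ d i s → 2 + (d * 2 + i) + s ≡ N → 2 + (d * 2 + i) ⟶ i
  evenJump jump with bothLong jump
  ... | N-1⟶0 , N⟶1 = go
    where
    N⟶below : ∀ q s → 2 + q + s ≡ N → N ⟶ q
    N⟶below q s eq with parity s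
    ... | m , inj₁ refl = N⟶evenBelow (N⟶N-2 N⟶1) m q (trans (rearrange m q) eq)
      where
      rearrange : ∀ m q → 2 + m * 2 + q ≡ 2 + q + m * 2
      rearrange = solve-∀
    ... | m , inj₂ refl = N⟶oddBelow m q (trans (rearrange m q) eq)
      where
      rearrange : ∀ m q → 3 + m * 2 + q ≡ 2 + q + (1 + m * 2)
      rearrange = solve-∀

    above⟶0 : ∀ b s → 2 + b + s ≡ N → 2 + b ⟶ 0
    above⟶0 b s eq with parity b
    ... | m , inj₁ refl = even⟶0 (2⟶0 N-1⟶0) m s eq
    ... | m , inj₂ refl = odd⟶0 m s eq

    go : ∀ d i s → 2 + (d * 2 + i) + s ≡ N → 2 + (d * 2 + i) ⟶ i
    go zero    zero    s eq = 2⟶0 N-1⟶0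
    -- The path is `3 + i … N → 1 … 1 + i`, which misses `0` and `2 + i`.
    go zero    (suc i) s eq =
      close 0 0 (runThenJump 1 s refl eq N⟶1 (run 1 i refl)) refl refl (+-identityʳ _)
    go (suc d) i       s eq = viaEnds i (d * 2) s eq
      (N⟶below (2 + i) (d * 2 + s) (trans (rearrange₁ d i s) eq))
      (above⟶0 (d * 2 + i) (2 + s) (trans (rearrange₂ d i s) eq))
      where
      rearrange₁ : ∀ d i s → 4 + i + (d * 2 + s) ≡ 4 + (d * 2 + i) + s
      rearrange₁ = solve-∀

      rearrange₂ : ∀ d i s → 2 + (d * 2 + i) + (2 + s) ≡ 4 + (d * 2 + i) + s
      rearrange₂ = solve-∀

  -- Adjacency of positions.

  evenArc⇒long : ∀ {i j} → i ≤ N → j ≤ N → isOdd i ≡ isOdd j → i ⟶ j → LongEvenJump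
  evenArc⇒long {i} {j} i≤N j≤N same i→j with <-cmp i j
  ... | tri≈ _ refl _ = ⊥-elim (Digraph.loopless D refl i→j)
  -- A positive even gap is at least two, so a forward arc over it would be a shortcut.
  ... | tri< i<j _ _ with d , refl ← evenGap i<j same =
    ⊥-elim (noShortcut (d * 2) (cong (2 +_) (+-comm i (d * 2))) j≤N i→j)
  ... | tri> _ _ j<i with d , refl ← evenGap j<i (sym same) | s , eq ← m≤n⇒∃[o]m+o≡n i≤N =
    long j d s eq i→j

  oddGap⇒adjacent : ∀ {i j} → i < j → j ≤ N → isOdd i ≢ isOdd j → Adjacent (x i) (x j)
  oddGap⇒adjacent {i} i<j j≤N differ
    with oddGap i<j differ | m≤n⇒∃[o]m+o≡n j≤N
  ... | zero  , refl | _      = inj₁ (step j≤N)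
  ... | suc d , refl | s , eq = inj₂ (oddJump d i s eq)

  long⇒adjacent : LongEvenJump → ∀ {i j} → i < j → j ≤ N → Adjacent (x i) (x j)
  long⇒adjacent jump {i} {j} i<j j≤N with isOdd i ≟ᵇ isOdd j
  ... | no differ = oddGap⇒adjacent i<j j≤N differ
  ... | yes same with d , refl ← evenGap i<j same | s , eq ← m≤n⇒∃[o]m+o≡n j≤N =
    inj₂ (evenJump jump d i s eq)

  -- Adjacency is symmetric, so ordered pairs suffice. `R` is trivial in the semicomplete case and
  -- says that the parities differ in the bipartite case.
  unordered : ∀ {i j} (R : ℕ → ℕ → Set) → (∀ {i j} → R i j → R j i) →
              (∀ {i j} → i < j → j ≤ N → R i j → Adjacent (x i) (x j)) →
              i ≤ N → j ≤ N → i ≢ j → R i j → Adjacent (x i) (x j)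
  unordered {i} {j} R R-sym ordered i≤N j≤N i≢j rij with <-cmp i j
  ... | tri< i<j _ _ = ordered i<j j≤N rij
  ... | tri≈ _ i≡j _ = ⊥-elim (i≢j i≡j)
  ... | tri> _ _ j<i = swap (ordered j<i i≤N (R-sym rij))

  -- Transfer to the induced subdigraph.

  S : Subset (Digraph.order D)
  S = vertexSet P

  index : ∀ a → ∃ λ t → Path.vertex P t ≡ enumerate S a
  index a = vertexSet⁻ P (enumerate-∈ S a)

  -- The numbering of `induced D S` follows the vertex order of `D`; this recovers the place along
  -- `P`.
  position : Fin ∣ S ∣ → ℕ
  position a = toℕ (proj₁ (index a))

  position≤N : ∀ a → position a ≤ N
  position≤N a = toℕ≤pred[n] (proj₁ (index a))

  x-position : ∀ a → x (position a) ≡ enumerate S a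
  x-position a = trans (sym (x-toℕ (proj₁ (index a)))) (proj₂ (index a))

  position-injective : ∀ {a b} → position a ≡ position b → a ≡ b
  position-injective {a} {b} eq = enumerate-injective S
    (trans (sym (x-position a)) (trans (cong x eq) (x-position b)))

  EvenArc : Set
  EvenArc = ∃₂ λ a b →
    isOdd (position a) ≡ isOdd (position b) × Digraph.Arc (induced D S) a b

  -- The final case distinction is constructive because there are finitely many vertices and arcs
  -- are decidable.
  evenArc? : Dec EvenArc
  evenArc? = any? λ a → any? λ b →
    (isOdd (position a) ≟ᵇ isOdd (position b)) ×-dec Digraph.arc? (induced D S) a b

  adjacentVertices : ∀ {a b} → Adjacent (x (position a)) (x (position b)) →
                     Digraph.Adjacent (induced D S) a b
  adjacentVertices {a} {b} = subst₂ Adjacent (x-position a) (x-position b)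

  semicomplete : EvenArc → Semicomplete (induced D S)
  semicomplete (a , b , same , a→b) c d c≢d = adjacentVertices
    (unordered (λ _ _ → ⊤) id (λ i<j j≤N _ → long⇒adjacent jump i<j j≤N)
      (position≤N c) (position≤N d) (c≢d ∘ position-injective) tt)
    where
    jump : LongEvenJump
    jump = evenArc⇒long (position≤N a) (position≤N b) same
      (subst₂ Arc (sym (x-position a)) (sym (x-position b)) a→b)

  bipartite : ¬ EvenArc → SemicompleteBipartite (induced D S)
  bipartite none = tabulate side , insideX , outsideX , between
    where
    side : Fin ∣ S ∣ → Bool
    side = isOdd ∘ position

    ∈⇒ : ∀ {a} → a ∈ tabulate side → side a ≡ true
    ∈⇒ {a} a∈X = trans (sym (lookup∘tabulate side a)) ([]=⇒lookup a∈X)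

    ∉⇒ : ∀ {a} → a ∉ tabulate side → side a ≡ false
    ∉⇒ {a} a∉X = ¬-not λ eq → a∉X (lookup⇒[]= a _ (trans (lookup∘tabulate side a) eq))

    insideX : ∀ a b → a ∈ tabulate side → b ∈ tabulate side → ¬ Digraph.Arc (induced D S) a b
    insideX a b a∈X b∈X a→b = none (a , b , trans (∈⇒ a∈X) (sym (∈⇒ b∈X)) , a→b)

    outsideX : ∀ a b → a ∉ tabulate side → b ∉ tabulate side → ¬ Digraph.Arc (induced D S) a b
    outsideX a b a∉X b∉X a→b = none (a , b , trans (∉⇒ a∉X) (sym (∉⇒ b∉X)) , a→b)

    between : ∀ a b → a ∈ tabulate side → b ∉ tabulate side → Digraph.Adjacent (induced D S) a b
    between a b a∈X b∉X = adjacentVertices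
      (unordered (λ i j → isOdd i ≢ isOdd j) ≢-sym oddGap⇒adjacent
        (position≤N a) (position≤N b) (differ ∘ cong isOdd) differ)
      where
      differ : side a ≢ side b
      differ eq with () ← trans (sym (∈⇒ a∈X)) (trans eq (∉⇒ b∉X))

  semicompleteOrBipartite : Semicomplete (induced D S) ⊎ SemicompleteBipartite (induced D S)
  semicompleteOrBipartite with evenArc?
  ... | yes arc  = inj₁ (semicomplete arc)
  ... | no  none = inj₂ (bipartite none)

-- Reduction to `k = 5 + r * 2`.

odd≥5 : ∀ k → k % 2 ≡ 1 → k ≥ 5 → ∃ λ r → k ≡ 5 + r * 2
odd≥5 k odd k≥5 with m≤n⇒∃[o]m+o≡n k≥5
... | e , refl with parity e
...   | r , inj₁ refl = r , refl
-- Here `k` is `(3 + r) * 2`, which leaves remainder 0.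
...   | r , inj₂ refl with () ← trans (sym (m*n%n≡0 (3 + r) 2)) odd

theorem2p5 : ∀ (k : ℕ) → k % 2 ≡ 1 → k ≥ 5 →
    ∀ (D : Digraph) → Strong D → QuasiTransitive D k →
    ∀ (diam : ℕ) → IsDiameter D diam → diam ≥ k + 2 →
    ∀ (u v : Vertex D) → IsDistance D u v (k + 2) →
    ∀ (l : ℕ) (P : Path D u v l) → Shortest D P →
    Semicomplete (induced D (vertexSet P)) ⊎ SemicompleteBipartite (induced D (vertexSet P))
theorem2p5 k odd k≥5 D _ qt _ _ _ u v (Q , Q-shortest) l P P-shortest
  with r , refl ← odd≥5 k odd k≥5
  -- Both `P` and `Q` are shortest, so their lengths agree and `l` becomes `7 + r * 2`.
  with refl ← trans (≤-antisym (P-shortest _ Q) (Q-shortest _ P)) (+-comm (5 + r * 2) 2)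
  = OddGeodesic.semicompleteOrBipartite r qt P P-shortest
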